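{- Let $p\geq 2$ and let $\sigma$ be the substitution on $\{ -1,1\}$ given by $\sigma(1)=v_0v_1\cdots v_{p-1}$, $\sigma(-1)=\bar v_0\bar v_1\cdots\bar v_{p-1}$, where $v_0=1$, $v_i\in\{ -1,1\}$ and $\bar v_i=-v_i$. Let $\mathbf{d}\in\{ -1,1\}^{\infty}$ be the fixed point of $\sigma$ starting with $1$. For $m\geq p$ define $v_m:=v_j$ where $m=np+j$ with $n\geq 0$ and $0\leq j\leq p-1$. (1) If $p$ is odd, then $\mathbf{d}$ is apwenian if and only if \[\frac{v_j+v_{j+1}-v_{2j+1}-v_{2j+2}}{2}\equiv 1\pmod 2,\quad 0\leq j\leq p-2.\] (2) If $p$ is even, then $\mathbf{d}$ is apwenian if and only if $\mathbf{d}$ is the Thue-Morse sequence, i.e. $d_0=1$, $d_{2n}=d_n$ and $d_{2n+1}=-d_n$ for all $n\geq 0$.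
   Context: For an integer sequence $\mathbf{a}$, $H_n(\mathbf{a})=\det(a_{i+j})_{0\leq i,j\leq n-1}$. A sequence $\mathbf{d}\in\{ -1,1\}^{\infty}$ is apwenian if $H_n(\mathbf{d})/2^{n-1}\equiv 1\pmod 2$ for all $n\geq 1$. -}

module Defs where

open import Data.Nat as ℕ using (ℕ; zero; suc; NonZero)
open import Data.Nat.DivMod using (_/_; _%_; m%n<n)
open import Data.Fin using (Fin; zero; suc; toℕ; fromℕ<; punchIn)
open import Data.Integer using (ℤ; _+_; _*_; -_; +_; _^_)
open import Data.Product using (Σ; _×_)
open import Data.Sum using (_⊎_)
open import Relation.Binary.PropositionalEquality using (_≡_)

∑ : (n : ℕ) → (Fin n → ℤ) → ℤ
∑ zero    f = + 0
∑ (suc n) f = f zero + ∑ n (λ i → f (suc i))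

det : (n : ℕ) → (Fin n → Fin n → ℤ) → ℤ
det zero    M = + 1
det (suc n) M =
  ∑ (suc n) (λ j → ((- (+ 1)) ^ toℕ j) * (M zero j * det n (λ i k → M (suc i) (punchIn j k))))

H : ℕ → (ℕ → ℤ) → ℤ
H n a = det n (λ i j → a (toℕ i ℕ.+ toℕ j))

IsSign : ℤ → Set
IsSign x = (x ≡ + 1) ⊎ (x ≡ - + 1)

Odd : ℤ → Set
Odd q = Σ ℤ (λ k → q ≡ + 1 + + 2 * k)

-- "x / c ≡ 1 (mod 2)" with c ∣ x: x = c * q for some odd q
QuotOdd : ℤ → ℤ → Set
QuotOdd c x = Σ ℤ (λ q → (x ≡ c * q) × Odd q)

Apwenian : (ℕ → ℤ) → Set
Apwenian d = (n : ℕ) → QuotOdd ((+ 2) ^ n) (H (suc n) d)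

vext : (p : ℕ) .{{_ : NonZero p}} → (Fin p → ℤ) → ℕ → ℤ
vext p v m = v (fromℕ< (m%n<n m p))

-- σ(d): the concatenation σ(d_0) σ(d_1) ⋯ ; its m-th letter, for m = np + j,
-- is the j-th letter of σ(d_n), i.e. d_n · v_j  (σ(1) = v, σ(-1) = v̄)
applyσ : (p : ℕ) .{{_ : NonZero p}} → (Fin p → ℤ) → (ℕ → ℤ) → ℕ → ℤ
applyσ p v d m = d (m / p) * vext p v m

IsFixedPointFrom1 : (p : ℕ) .{{_ : NonZero p}} → (Fin p → ℤ) → (ℕ → ℤ) → Set
IsFixedPointFrom1 p v d = ((m : ℕ) → IsSign (d m)) × (d 0 ≡ + 1) × ((m : ℕ) → applyσ p v d m ≡ d m)

ThueMorse : (ℕ → ℤ) → Set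
ThueMorse d = (d 0 ≡ + 1) × ((n : ℕ) → d (2 ℕ.* n) ≡ d n) × ((n : ℕ) → d (suc (2 ℕ.* n)) ≡ - d n)

{-# OPTIONS --safe #-}
module Submission where

-- Write d_n = (-1)^(e_n).  Pivoting on d_0 = 1 gives H_{n+1}(d) = det(d_{i+j} - d_i d_j)_{1≤i,j≤n}, all of
-- whose entries are even, so H_{n+1}(d) / 2^n is the determinant of a matrix congruent mod 2 to
-- B_ij = e_{i+j+2} + e_{i+1} + e_{j+1} (0 ≤ i,j < n).  This B has displacement structure
--   B_{i,j+1} + B_{i+1,j} = φ_i h_j + h_i φ_j,   h_j = B_{j,0},
-- with φ = 1.  The Schur complement of such a matrix has the same structure, with φ_n replaced by h_{n+1},
-- and over F_2 it merely shifts the "defect" sequence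
--   1 + B_00,   B_{n+1,n+1} + B_{n,n+1} + (φ_n ∨ h_n).
-- Hence all leading minors of B are odd iff all defects vanish, i.e. iff
--   t_n = e_n + e_{n+1} + e_{2n+1} + e_{2n+2} = 1 for all n.
-- For p odd, t_n depends only on n mod p unless n + 1 = (q+1)p for some q, when t_n = t_q.
-- For p = 2k, the equations at n = k-1+qp give e_{2q} + e_{2q+1} = e_1, so g_n = e_n + e_{2n} satisfies
-- g_{n+1} = g_n + 1 + e_1; now 0 = g_p = e_1 + e_2 = g_1 forces e_1 = 1 and g = 0.

open import Defs
open import Data.Bool using (Bool; true; false; not; _∧_; _∨_; _xor_)
open import Data.Bool.Properties using (xor-same; xor-comm; xor-identityʳ; ∧-identityʳ; ∧-idem; ∧-comm; not-involutive)
open import Data.Bool.Solver using (module xor-∧-Solver)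
open import Data.Empty using (⊥; ⊥-elim)
open import Data.Nat as ℕ using (ℕ; zero; suc; NonZero; _≤_; _<_; pred; z<s; s<s)
import Data.Nat.Properties as ℕ
open import Data.Nat.DivMod using (_/_; _%_; m%n<n; m≡m%n+[m/n]*n; [m+kn]%n≡m%n; m<n⇒m/n≡0; m*n/n≡m; +-distrib-/-∣ʳ)
open import Data.Nat.Divisibility using (_∣_; divides; _∣?_; n∣m*n; >⇒∤; ∣m+n∣m⇒∣n; m%n≡0⇒n∣m; n∣m⇒m%n≡0)
open import Data.Nat.Induction using (<-rec)
open import Data.Nat.Primality using (euclidsLemma; prime[2])
import Data.Nat.Tactic.RingSolver as ℕ-Solver
open import Data.Fin using (Fin; zero; suc; toℕ; fromℕ<; punchIn)
open import Data.Fin.Properties using (fromℕ<-cong)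
open import Data.Integer as ℤ using (ℤ; _+_; _-_; _*_; -_; +_; _^_; ∣_∣)
import Data.Integer.Properties as ℤ
open import Data.Integer.Tactic.RingSolver using (solve-∀)
open import Data.List using (List; []; _∷_; _++_; map; tabulate)
open import Data.List.Properties using (map-tabulate)
open import Data.Product using (_×_; _,_)
open import Data.Sum using (inj₁; inj₂)
open import Function using (_∘_)
open import Function.Bundles using (_⇔_; mk⇔; Equivalence)
open import Function.Construct.Composition using (_⇔-∘_)
open import Relation.Nullary using (¬_; yes; no; contradiction)
open import Relation.Binary.PropositionalEquality using (_≡_; refl; sym; trans; cong; cong₂; subst; module ≡-Reasoning)
open ≡-Reasoning
open xor-∧-Solver using (solve; _:=_; _:+_; _:*_; con)

-- Determinants

∑-cong : ∀ n {f g : Fin n → ℤ} → (∀ i → f i ≡ g i) → ∑ n f ≡ ∑ n g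
∑-cong zero    f≗g = refl
∑-cong (suc n) f≗g = cong₂ _+_ (f≗g zero) (∑-cong n (f≗g ∘ suc))

∑-distribˡ : ∀ n c (f : Fin n → ℤ) → ∑ n (λ i → c * f i) ≡ c * ∑ n f
∑-distribˡ zero    c f = sym (ℤ.*-zeroʳ c)
∑-distribˡ (suc n) c f = begin
  c * f zero + ∑ n (λ i → c * f (suc i)) ≡⟨ cong (_+_ (c * f zero)) (∑-distribˡ n c (f ∘ suc)) ⟩
  c * f zero + c * ∑ n (f ∘ suc)         ≡⟨ sym (ℤ.*-distribˡ-+ c (f zero) (∑ n (f ∘ suc))) ⟩
  c * (f zero + ∑ n (f ∘ suc))           ∎

det-cong : ∀ n {M N : Fin n → Fin n → ℤ} → (∀ i j → M i j ≡ N i j) → det n M ≡ det n N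
det-cong zero    M≗N = refl
det-cong (suc n) M≗N = ∑-cong (suc n) λ j →
  cong (((- (+ 1)) ^ toℕ j) *_) (cong₂ _*_ (M≗N zero j) (det-cong n λ i k → M≗N (suc i) (punchIn j k)))

det-scale : ∀ n c (M : Fin n → Fin n → ℤ) → det n (λ i j → c * M i j) ≡ c ^ n * det n M
det-scale zero    c M = refl
det-scale (suc n) c M = begin
  ∑ (suc n) (λ j → ((- (+ 1)) ^ toℕ j) * ((c * M zero j) * det n (λ i k → c * minor j i k)))
    ≡⟨ ∑-cong (suc n) (λ j → trans
         (cong (λ z → ((- (+ 1)) ^ toℕ j) * ((c * M zero j) * z)) (det-scale n c (minor j)))
         (rearrange ((- (+ 1)) ^ toℕ j) c (M zero j) (c ^ n) (det n (minor j)))) ⟩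
  ∑ (suc n) (λ j → c ^ suc n * (((- (+ 1)) ^ toℕ j) * (M zero j * det n (minor j))))
    ≡⟨ ∑-distribˡ (suc n) (c ^ suc n) (λ j → ((- (+ 1)) ^ toℕ j) * (M zero j * det n (minor j))) ⟩
  c ^ suc n * det (suc n) M ∎
  where
  minor : Fin (suc n) → Fin n → Fin n → ℤ
  minor j i k = M (suc i) (punchIn j k)
  rearrange : ∀ s c m t x → s * ((c * m) * (t * x)) ≡ (c * t) * (s * (m * x))
  rearrange = solve-∀

-- The columns already passed over are absorbed into the functional F, so the
-- expansion along a row is a structural recursion on the list of columns.
expand : {A : Set} → (A → ℤ) → (List A → ℤ) → List A → ℤ
expand h F []       = + 0
expand h F (c ∷ cs) = h c * F cs - expand h (λ ds → F (c ∷ ds)) cs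

-- The default `+ 0` for surplus columns, together with the empty case of `expand`, makes `detL`
-- vanish whenever the numbers of rows and columns differ. The laws below then hold for lists of
-- every length, with no length hypotheses.
detL : {A : Set} (n : ℕ) → (Fin n → A → ℤ) → List A → ℤ
detL zero    ρ []      = + 1
detL zero    ρ (_ ∷ _) = + 0
detL (suc n) ρ         = expand (ρ zero) (detL n (ρ ∘ suc))

-- Each column passed over negates the rest of the expansion, so column `j` collects the cofactor
-- sign (-1)^j, and the columns left for `F` are those enumerated by `punchIn j`.
expand-tabulate : ∀ {A : Set} n (h : A → ℤ) F (g : Fin (suc n) → A) →
  expand h F (tabulate g) ≡
  ∑ (suc n) (λ j → ((- (+ 1)) ^ toℕ j) * (h (g j) * F (tabulate (g ∘ punchIn j))))
expand-tabulate zero    h F g = base (h (g zero) * F [])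
  where
  base : ∀ a → a - + 0 ≡ + 1 * a + + 0
  base = solve-∀
expand-tabulate (suc n) h F g = begin
  a - expand h F′ (tabulate (g ∘ suc))
    ≡⟨ cong (_-_ a) (expand-tabulate n h F′ (g ∘ suc)) ⟩
  a - ∑ (suc n) f
    ≡⟨ step a (∑ (suc n) f) ⟩
  + 1 * a + - + 1 * ∑ (suc n) f
    ≡⟨ cong (_+_ (+ 1 * a)) (sym (∑-distribˡ (suc n) (- + 1) f)) ⟩
  + 1 * a + ∑ (suc n) (λ j → - + 1 * f j)
    ≡⟨ cong (_+_ (+ 1 * a)) (∑-cong (suc n) λ j →
         sym (ℤ.*-assoc (- + 1) ((- + 1) ^ toℕ j) (h (g (suc j)) * F′ (tabulate (g ∘ suc ∘ punchIn j))))) ⟩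
  + 1 * a + ∑ (suc n) (λ j → ((- (+ 1)) ^ toℕ (suc j)) * (h (g (suc j)) * F (tabulate (g ∘ punchIn (suc j))))) ∎
  where
  a : ℤ
  a = h (g zero) * F (tabulate (g ∘ suc))
  F′ : List _ → ℤ
  F′ ds = F (g zero ∷ ds)
  f : Fin (suc n) → ℤ
  f j = ((- (+ 1)) ^ toℕ j) * (h (g (suc j)) * F′ (tabulate (g ∘ suc ∘ punchIn j)))
  step : ∀ a b → a - b ≡ + 1 * a + - + 1 * b
  step = solve-∀

det≡detL : ∀ {A : Set} n (ρ : Fin n → A → ℤ) (g : Fin n → A) →
  det n (λ i j → ρ i (g j)) ≡ detL n ρ (tabulate g)
det≡detL zero    ρ g = refl
det≡detL (suc n) ρ g = trans
  (∑-cong (suc n) λ j → cong (λ z → ((- (+ 1)) ^ toℕ j) * (ρ zero (g j) * z)) (det≡detL n (ρ ∘ suc) (g ∘ punchIn j)))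
  (sym (expand-tabulate n (ρ zero) (detL n (ρ ∘ suc)) g))

zero-combine : ∀ t → + 0 ≡ + 0 - t * + 0
zero-combine = solve-∀

combine : ∀ h g t k a b → h * (g - t * k) - (a - t * b) ≡ (h * g - a) - t * (h * k - b)
combine = solve-∀

negate : ∀ h g a → h * (- g) - (- a) ≡ - (h * g - a)
negate = solve-∀

-- Multilinear and alternating functionals on lists of columns

module _ {A : Set} (sub : A → ℤ → A → A) where

  Linear : (A → ℤ) → Set
  Linear h = ∀ y t x → h (sub y t x) ≡ h y - t * h x

  Multilinear : (List A → ℤ) → Set
  Multilinear F = ∀ pre y t x post →
    F (pre ++ sub y t x ∷ post) ≡ F (pre ++ y ∷ post) - t * F (pre ++ x ∷ post)

  -- Two laws in one: replacing `y` by y - t x next to `x` changes nothing, and swapping neighbours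
  -- changes the sign. This is exactly the move that carries a pivot `x` one place to the right.
  Alternating : (List A → ℤ) → Set
  Alternating F = ∀ pre y t x post →
    F (pre ++ sub y t x ∷ x ∷ post) ≡ - F (pre ++ x ∷ y ∷ post)

  expand-combine : ∀ h t {F G K : List A → ℤ} → (∀ cs → F cs ≡ G cs - t * K cs) →
    ∀ cs → expand h F cs ≡ expand h G cs - t * expand h K cs
  expand-combine h t eq []       = zero-combine t
  expand-combine h t {F} {G} {K} eq (c ∷ cs) = trans
    (cong₂ (λ u w → h c * u - w) (eq cs) (expand-combine h t (λ ds → eq (c ∷ ds)) cs))
    (combine (h c) (G cs) t (K cs) _ _)

  expand-neg : ∀ h {F G : List A → ℤ} → (∀ cs → F cs ≡ - G cs) →
    ∀ cs → expand h F cs ≡ - expand h G cs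
  expand-neg h eq []       = refl
  expand-neg h {F} {G} eq (c ∷ cs) = trans
    (cong₂ (λ u w → h c * u - w) (eq cs) (expand-neg h (λ ds → eq (c ∷ ds)) cs))
    (negate (h c) (G cs) _)

  expand-multilinear : ∀ {h F} → Linear h → Multilinear F → Multilinear (expand h F)
  expand-multilinear {h} {F} lin mul [] y t x post = trans
    (cong₂ (λ u w → u * F post - w) (lin y t x) (expand-combine h t (λ ds → mul [] y t x ds) post))
    (step (h y) t (h x) (F post) _ _)
    where
    step : ∀ y t x f a b → (y - t * x) * f - (a - t * b) ≡ (y * f - a) - t * (x * f - b)
    step = solve-∀
  expand-multilinear {h} {F} lin mul (c ∷ pre) y t x post = trans
    (cong₂ (λ u w → h c * u - w) (mul pre y t x post)
      (expand-multilinear lin (λ pre′ → mul (c ∷ pre′)) pre y t x post))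
    (combine (h c) _ t _ _ _)

  -- When the two columns come first, linearity of `h` and of `F` each produce a term t (h x) F(x,
  -- ...), and the two cancel. A longer prefix is absorbed into `F`.
  expand-alternating : ∀ {h F} → Linear h → Multilinear F → Alternating F → Alternating (expand h F)
  expand-alternating {h} {F} lin mul alt [] y t x post = begin
    h (sub y t x) * F (x ∷ post) - (h x * F (sub y t x ∷ post) - expand h (λ ds → F (sub y t x ∷ x ∷ ds)) post)
      ≡⟨ cong₂ (λ u w → u * F (x ∷ post) - (h x * F (sub y t x ∷ post) - w)) (lin y t x)
           (expand-neg h (λ ds → alt [] y t x ds) post) ⟩
    (h y - t * h x) * F (x ∷ post) - (h x * F (sub y t x ∷ post) - - E)
      ≡⟨ cong (λ u → (h y - t * h x) * F (x ∷ post) - (h x * u - - E)) (mul [] y t x post) ⟩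
    (h y - t * h x) * F (x ∷ post) - (h x * (F (y ∷ post) - t * F (x ∷ post)) - - E)
      ≡⟨ step (h y) t (h x) (F (x ∷ post)) (F (y ∷ post)) E ⟩
    - (h x * F (y ∷ post) - (h y * F (x ∷ post) - E)) ∎
    where
    E : ℤ
    E = expand h (λ ds → F (x ∷ y ∷ ds)) post
    step : ∀ y t x fx fy e →
      (y - t * x) * fx - (x * (fy - t * fx) - - e) ≡ - (x * fy - (y * fx - e))
    step = solve-∀
  expand-alternating {h} {F} lin mul alt (c ∷ pre) y t x post = trans
    (cong₂ (λ u w → h c * u - w) (alt pre y t x post)
      (expand-alternating lin (λ pre′ → mul (c ∷ pre′)) (λ pre′ → alt (c ∷ pre′)) pre y t x post))
    (negate (h c) _ _)

  detL-multilinear : ∀ n {ρ : Fin n → A → ℤ} → (∀ i → Linear (ρ i)) → Multilinear (detL n ρ)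
  detL-multilinear zero    lin []        y t x post = zero-combine t
  detL-multilinear zero    lin (_ ∷ pre) y t x post = zero-combine t
  detL-multilinear (suc n) lin = expand-multilinear (lin zero) (detL-multilinear n (lin ∘ suc))

  detL-alternating : ∀ n {ρ : Fin n → A → ℤ} → (∀ i → Linear (ρ i)) → Alternating (detL n ρ)
  detL-alternating zero    lin []        y t x post = refl
  detL-alternating zero    lin (_ ∷ pre) y t x post = refl
  detL-alternating (suc n) lin =
    expand-alternating (lin zero) (detL-multilinear n (lin ∘ suc)) (detL-alternating n (lin ∘ suc))

  -- Moving the pivot x past y replaces y by y - (h y) x.
  expand-pivot : ∀ {h F} → Multilinear F → Alternating F → ∀ x → h x ≡ + 1 → ∀ ys →
    expand h F (x ∷ ys) ≡ F (map (λ y → sub y (h y) x) ys)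
  expand-pivot {h} {F} mul alt x hx≡1 []       = trans (cong (λ u → u * F [] - + 0) hx≡1) (base (F []))
    where
    base : ∀ a → + 1 * a - + 0 ≡ a
    base = solve-∀
  expand-pivot {h} {F} mul alt x hx≡1 (y ∷ ys) = begin
    h x * F (y ∷ ys) - (h y * F (x ∷ ys) - E)
      ≡⟨ cong (λ u → u * F (y ∷ ys) - (h y * F (x ∷ ys) - E)) hx≡1 ⟩
    + 1 * F (y ∷ ys) - (h y * F (x ∷ ys) - E)
      ≡⟨ step (F (y ∷ ys)) (h y) (F (x ∷ ys)) E ⟩
    + 1 * (F (y ∷ ys) - h y * F (x ∷ ys)) - - E
      ≡⟨ sym (cong₂ (λ u w → + 1 * u - w) (mul [] y (h y) x ys) (expand-neg h (λ ds → alt [] y (h y) x ds) ys)) ⟩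
    + 1 * F (y′ ∷ ys) - expand h (λ ds → F (y′ ∷ x ∷ ds)) ys
      ≡⟨ cong (λ u → u * F (y′ ∷ ys) - expand h (λ ds → F (y′ ∷ x ∷ ds)) ys) (sym hx≡1) ⟩
    expand h (λ ds → F (y′ ∷ ds)) (x ∷ ys)
      ≡⟨ expand-pivot {h} {λ ds → F (y′ ∷ ds)} (λ pre → mul (y′ ∷ pre)) (λ pre → alt (y′ ∷ pre)) x hx≡1 ys ⟩
    F (y′ ∷ map (λ y → sub y (h y) x) ys) ∎
    where
    y′ : A
    y′ = sub y (h y) x
    E : ℤ
    E = expand h (λ ds → F (x ∷ y ∷ ds)) ys
    step : ∀ fy hy fx e → + 1 * fy - (hy * fx - e) ≡ + 1 * (fy - hy * fx) - - e
    step = solve-∀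

-- Rows act on columns by evaluation, which is linear by `refl`. Carrying column `zero` past the
-- others clears row `zero`; since the pivot is 1, no division occurs and the identity holds over
-- the integers.
det-schur : ∀ n (M : Fin (suc n) → Fin (suc n) → ℤ) → M zero zero ≡ + 1 →
  det (suc n) M ≡ det n (λ i j → M (suc i) (suc j) - M zero (suc j) * M (suc i) zero)
det-schur n M M₀₀≡1 = begin
  det (suc n) M
    ≡⟨ det≡detL (suc n) row col ⟩
  detL (suc n) row (tabulate col)
    ≡⟨ expand-pivot sub {row zero} {detL n (row ∘ suc)}
         (detL-multilinear sub n λ i y t x → refl) (detL-alternating sub n λ i y t x → refl)
         (col zero) M₀₀≡1 (tabulate (col ∘ suc)) ⟩
  detL n (row ∘ suc) (map (λ y → sub y (y zero) (col zero)) (tabulate (col ∘ suc)))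
    ≡⟨ cong (detL n (row ∘ suc)) (map-tabulate (col ∘ suc) _) ⟩
  detL n (row ∘ suc) (tabulate (λ j → sub (col (suc j)) (M zero (suc j)) (col zero)))
    ≡⟨ sym (det≡detL n (row ∘ suc) _) ⟩
  det n (λ i j → M (suc i) (suc j) - M zero (suc j) * M (suc i) zero) ∎
  where
  Column : Set
  Column = Fin (suc n) → ℤ
  sub : Column → ℤ → Column → Column
  sub y t x i = y i - t * x i
  row : Fin (suc n) → Column → ℤ
  row i c = c i
  col : Fin (suc n) → Column
  col j i = M i j

-- Parity

infix 4 _≈₂_ _~_

data _≈₂_ (x y : ℤ) : Set where
  mod2 : ∀ k → x ≡ y + + 2 * k → x ≈₂ y

bit : Bool → ℤ
bit false = + 0
bit true  = + 1

_~_ : ℤ → Bool → Set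
x ~ b = x ≈₂ bit b

≈₂-reflexive : ∀ {x y} → x ≡ y → x ≈₂ y
≈₂-reflexive {x} refl = mod2 (+ 0) (lemma x)
  where
  lemma : ∀ x → x ≡ x + + 2 * + 0
  lemma = solve-∀

≈₂-trans : ∀ {x y z} → x ≈₂ y → y ≈₂ z → x ≈₂ z
≈₂-trans {z = z} (mod2 k refl) (mod2 l refl) = mod2 (l + k) (lemma z k l)
  where
  lemma : ∀ z k l → (z + + 2 * l) + + 2 * k ≡ z + + 2 * (l + k)
  lemma = solve-∀

+-cong₂ : ∀ {x y u w} → x ≈₂ y → u ≈₂ w → x + u ≈₂ y + w
+-cong₂ {y = y} {w = w} (mod2 k refl) (mod2 l refl) = mod2 (k + l) (lemma y w k l)
  where
  lemma : ∀ y w k l → (y + + 2 * k) + (w + + 2 * l) ≡ (y + w) + + 2 * (k + l)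
  lemma = solve-∀

*-cong₂ : ∀ {x y u w} → x ≈₂ y → u ≈₂ w → x * u ≈₂ y * w
*-cong₂ {y = y} {w = w} (mod2 k refl) (mod2 l refl) = mod2 (k * w + y * l + + 2 * k * l) (lemma y w k l)
  where
  lemma : ∀ y w k l → (y + + 2 * k) * (w + + 2 * l) ≡ y * w + + 2 * (k * w + y * l + + 2 * k * l)
  lemma = solve-∀

∑-cong₂ : ∀ n {f g : Fin n → ℤ} → (∀ i → f i ≈₂ g i) → ∑ n f ≈₂ ∑ n g
∑-cong₂ zero    f≈g = ≈₂-reflexive refl
∑-cong₂ (suc n) f≈g = +-cong₂ (f≈g zero) (∑-cong₂ n (f≈g ∘ suc))

det-cong₂ : ∀ n {M N : Fin n → Fin n → ℤ} → (∀ i j → M i j ≈₂ N i j) → det n M ≈₂ det n N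
det-cong₂ zero    M≈N = ≈₂-reflexive refl
det-cong₂ (suc n) {M} M≈N = ∑-cong₂ (suc n) λ j →
  *-cong₂ (≈₂-reflexive {(- (+ 1)) ^ toℕ j} refl)
    (*-cong₂ (M≈N zero j) (det-cong₂ n λ i k → M≈N (suc i) (punchIn j k)))

minus-~ : ∀ {x y} a b → x ~ a → y ~ b → x - y ~ a xor b
minus-~ a b (mod2 k refl) (mod2 l refl) = lemma a b
  where
  lemma : ∀ a b → (bit a + + 2 * k) - (bit b + + 2 * l) ~ a xor b
  lemma false false = mod2 (k - l) (eq k l)
    where
    eq : ∀ k l → (+ 0 + + 2 * k) - (+ 0 + + 2 * l) ≡ + 0 + + 2 * (k - l)
    eq = solve-∀
  lemma false true  = mod2 (k - l - + 1) (eq k l)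
    where
    eq : ∀ k l → (+ 0 + + 2 * k) - (+ 1 + + 2 * l) ≡ + 1 + + 2 * (k - l - + 1)
    eq = solve-∀
  lemma true  false = mod2 (k - l) (eq k l)
    where
    eq : ∀ k l → (+ 1 + + 2 * k) - (+ 0 + + 2 * l) ≡ + 1 + + 2 * (k - l)
    eq = solve-∀
  lemma true  true  = mod2 (k - l) (eq k l)
    where
    eq : ∀ k l → (+ 1 + + 2 * k) - (+ 1 + + 2 * l) ≡ + 0 + + 2 * (k - l)
    eq = solve-∀

bit-~ : ∀ b → bit b ~ b
bit-~ b = ≈₂-reflexive refl

bit-∧ : ∀ a b → bit a * bit b ≡ bit (a ∧ b)
bit-∧ false b     = refl
bit-∧ true  false = refl
bit-∧ true  true  = refl

odd≢even : ∀ {x} → x ~ true → x ~ false → ⊥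
odd≢even (mod2 k refl) (mod2 l eq) = two∤one ∣ l - k ∣ (begin
  2 ℕ.* ∣ l - k ∣ ≡⟨ sym (ℤ.abs-* (+ 2) (l - k)) ⟩
  ∣ + 2 * (l - k) ∣ ≡⟨ cong ∣_∣ (trans (lemma k l) (trans (cong (_- + 2 * k) (sym eq)) (lemma′ k))) ⟩
  1 ∎)
  where
  lemma : ∀ k l → + 2 * (l - k) ≡ (+ 0 + + 2 * l) - + 2 * k
  lemma = solve-∀
  lemma′ : ∀ k → (+ 1 + + 2 * k) - + 2 * k ≡ + 1
  lemma′ = solve-∀
  two∤one : ∀ m → 2 ℕ.* m ≡ 1 → ⊥
  two∤one (suc m) eq with trans (sym (ℕ.+-suc m (m ℕ.+ 0))) (ℕ.suc-injective eq)
  ... | ()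

-- Cancelling the nonzero `c` shows that the quotient is unique, so the parity of any one known
-- quotient decides.
quotOdd-⇔ : ∀ {c x q b} .{{_ : ℤ.NonZero c}} → x ≡ c * q → q ~ b → QuotOdd c x ⇔ b ≡ true
quotOdd-⇔ {c} {x} {q} {b} x≡cq q~b = mk⇔ (to b q~b) from
  where
  to : ∀ b → q ~ b → QuotOdd c x → b ≡ true
  to true  _   _                = refl
  to false q~f (q′ , eq , k , odd) =
    ⊥-elim (odd≢even (mod2 k (trans (ℤ.*-cancelˡ-≡ c q q′ (trans (sym x≡cq) eq)) odd)) q~f)
  from : b ≡ true → QuotOdd c x
  from b≡true with subst (q ~_) b≡true q~b
  ... | mod2 k odd = q , x≡cq , k , odd

-- Elimination mod 2

record Admissible (φ : ℕ → Bool) (B : ℕ → ℕ → Bool) : Set where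
  field
    symmetric : ∀ i j → B i j ≡ B j i
    shift     : ∀ i j → B i (suc j) ≡ B (suc i) j xor ((φ i ∧ B j 0) xor (B i 0 ∧ φ j))

-- Chosen so that elimination shifts it: as long as the earlier terms vanish, the term at `n` is the
-- complement of the pivot met after `n` elimination steps.
defect : (ℕ → Bool) → (ℕ → ℕ → Bool) → ℕ → Bool
defect φ B zero    = not (B 0 0)
defect φ B (suc n) = (B (suc n) (suc n) xor B n (suc n)) xor (φ n ∨ B n 0)

schur : (ℕ → ℕ → Bool) → ℕ → ℕ → Bool
schur B i j = B (suc i) (suc j) xor (B (suc i) 0 ∧ B (suc j) 0)

module _ {φ B} (adm : Admissible φ B) (B₀₀ : B 0 0 ≡ true) where
  open Admissible adm

  -- The displacement equation trades column 1 for column 0. The new first column thus depends only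
  -- on the old one and on `φ`, which reduces the next two lemmas to Boolean identities.
  schur-column₀ : ∀ n → schur B n 0 ≡
    (B (suc (suc n)) 0 xor (φ (suc n) xor (B (suc n) 0 ∧ φ 0))) xor (B (suc n) 0 ∧ B 1 0)
  schur-column₀ n = cong (_xor (B (suc n) 0 ∧ B 1 0)) (begin
    B (suc n) 1
      ≡⟨ shift (suc n) 0 ⟩
    B (suc (suc n)) 0 xor ((φ (suc n) ∧ B 0 0) xor (B (suc n) 0 ∧ φ 0))
      ≡⟨ cong (λ b → B (suc (suc n)) 0 xor (b xor (B (suc n) 0 ∧ φ 0)))
           (trans (cong (φ (suc n) ∧_) B₀₀) (∧-identityʳ _)) ⟩
    B (suc (suc n)) 0 xor (φ (suc n) xor (B (suc n) 0 ∧ φ 0)) ∎)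

  schur-admissible : Admissible (λ n → B (suc n) 0) (schur B)
  schur-admissible .Admissible.symmetric i j =
    cong₂ _xor_ (symmetric (suc i) (suc j)) (∧-comm (B (suc i) 0) (B (suc j) 0))
  schur-admissible .Admissible.shift i j = begin
    schur B i (suc j)
      ≡⟨ cong (_xor (B (suc i) 0 ∧ B (suc (suc j)) 0)) (shift (suc i) (suc j)) ⟩
    (B (suc (suc i)) (suc j) xor ((φ (suc i) ∧ B (suc j) 0) xor (B (suc i) 0 ∧ φ (suc j))))
      xor (B (suc i) 0 ∧ B (suc (suc j)) 0)
      -- The terms in `φ₀` and `h₁` carry the factor `hi` times `hj`, symmetric in the two indices,
      -- so each occurs twice and cancels.
      ≡⟨ solve 9 (λ x φi φj hi hj ki kj φ₀ h₁ →
           (x :+ ((φi :* hj) :+ (hi :* φj))) :+ (hi :* kj) :=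
           (x :+ (ki :* hj)) :+
             ((hi :* ((kj :+ (φj :+ (hj :* φ₀))) :+ (hj :* h₁))) :+
              (((ki :+ (φi :+ (hi :* φ₀))) :+ (hi :* h₁)) :* hj))) refl
           (B (suc (suc i)) (suc j)) (φ (suc i)) (φ (suc j)) (B (suc i) 0) (B (suc j) 0)
           (B (suc (suc i)) 0) (B (suc (suc j)) 0) (φ 0) (B 1 0) ⟩
    _ ≡⟨ sym (cong₂ (λ a b → schur B (suc i) j xor ((B (suc i) 0 ∧ a) xor (b ∧ B (suc j) 0)))
           (schur-column₀ j) (schur-column₀ i)) ⟩
    schur B (suc i) j xor ((B (suc i) 0 ∧ schur B j 0) xor (schur B i 0 ∧ B (suc j) 0)) ∎

  -- Let h and k be the entries of column 0 in rows n+1 and n+2. If h is 1, both disjunctions are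
  -- true and the two copies of k in the Schur entries cancel. If h is 0, the k from the diagonal
  -- entry cancels the k in the new first column, leaving `φ (suc n)`.
  schur-defect : ∀ n → defect (λ n → B (suc n) 0) (schur B) n ≡ defect φ B (suc n)
  schur-defect zero = begin
    not (B 1 1 xor (B 1 0 ∧ B 1 0))
      ≡⟨ lemma (B 1 1) (B 1 0) (φ 0) ⟩
    (B 1 1 xor B 1 0) xor (φ 0 ∨ true)
      ≡⟨ cong₂ (λ a b → (B 1 1 xor a) xor (φ 0 ∨ b)) (symmetric 1 0) (sym B₀₀) ⟩
    (B 1 1 xor B 0 1) xor (φ 0 ∨ B 0 0) ∎
    where
    lemma : ∀ a h f → not (a xor (h ∧ h)) ≡ (a xor h) xor (f ∨ true)
    lemma false false false = refl
    lemma false false true  = refl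
    lemma false true  false = refl
    lemma false true  true  = refl
    lemma true  false false = refl
    lemma true  false true  = refl
    lemma true  true  false = refl
    lemma true  true  true  = refl
  schur-defect (suc n) = begin
    (schur B (suc n) (suc n) xor schur B n (suc n)) xor (h ∨ schur B n 0)
      ≡⟨ cong (λ u → (schur B (suc n) (suc n) xor schur B n (suc n)) xor (h ∨ u)) (schur-column₀ n) ⟩
    ((a xor (k ∧ k)) xor (c xor (h ∧ k))) xor (h ∨ ((k xor (φ (suc n) xor (h ∧ φ 0))) xor (h ∧ B 1 0)))
      ≡⟨ cong (λ u → ((a xor u) xor (c xor (h ∧ k))) xor (h ∨ ((k xor (φ (suc n) xor (h ∧ φ 0))) xor (h ∧ B 1 0))))
           (∧-idem k) ⟩
    ((a xor k) xor (c xor (h ∧ k))) xor (h ∨ ((k xor (φ (suc n) xor (h ∧ φ 0))) xor (h ∧ B 1 0)))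
      ≡⟨ lemma h (φ (suc n)) a c k (φ 0) (B 1 0) ⟩
    (a xor c) xor (φ (suc n) ∨ h) ∎
    where
    a c h k : Bool
    a = B (suc (suc n)) (suc (suc n))
    c = B (suc n) (suc (suc n))
    h = B (suc n) 0
    k = B (suc (suc n)) 0
    lemma : ∀ h f a c k f₀ h₁ →
      ((a xor k) xor (c xor (h ∧ k))) xor (h ∨ ((k xor (f xor (h ∧ f₀))) xor (h ∧ h₁))) ≡
      (a xor c) xor (f ∨ h)
    lemma false false a c k f₀ h₁ = solve 3 (λ a c k →
      ((a :+ k) :+ (c :+ con false)) :+ ((k :+ con false) :+ con false) := (a :+ c) :+ con false) refl a c k
    lemma false true  a c k f₀ h₁ = solve 3 (λ a c k →
      ((a :+ k) :+ (c :+ con false)) :+ ((k :+ con true) :+ con false) := (a :+ c) :+ con true) refl a c k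
    lemma true  false a c k f₀ h₁ = solve 3 (λ a c k →
      ((a :+ k) :+ (c :+ k)) :+ con true := (a :+ c) :+ con true) refl a c k
    lemma true  true  a c k f₀ h₁ = solve 3 (λ a c k →
      ((a :+ k) :+ (c :+ k)) :+ con true := (a :+ c) :+ con true) refl a c k

not≡false⇒true : ∀ {b} → not b ≡ false → b ≡ true
not≡false⇒true {true} _ = refl

-- Induction over all `φ` and `B` at once, since elimination changes both. The vanishing defects
-- before `N` supply the pivots; the defect at `N` is left free, so that the parity can be read off
-- in both directions.
det-defect : ∀ N φ {B} → Admissible φ B → (∀ k → k < N → defect φ B k ≡ false) →
  det (suc N) (λ i j → bit (B (toℕ i) (toℕ j))) ~ not (defect φ B N)
det-defect zero    φ {B} adm _     = ≈₂-reflexive (trans (lemma (bit (B 0 0))) (cong bit (sym (not-involutive (B 0 0)))))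
  where
  lemma : ∀ x → + 1 * (x * + 1) + + 0 ≡ x
  lemma = solve-∀
det-defect (suc N) φ {B} adm small = ≈₂-trans
  -- The 0/1 lift has pivot exactly 1, so the Schur complement is taken over the integers and only
  -- afterwards reduced entrywise mod 2.
  (≈₂-trans (≈₂-reflexive (det-schur (suc N) M (cong bit B₀₀)))
    (det-cong₂ (suc N) λ i j → minus-~ _ (B (suc (toℕ i)) 0 ∧ B (suc (toℕ j)) 0) (bit-~ (B (suc (toℕ i)) (suc (toℕ j))))
      (≈₂-reflexive (trans (cong (λ b → bit b * bit (B (suc (toℕ i)) 0)) (symmetric 0 (suc (toℕ j))))
        (trans (bit-∧ (B (suc (toℕ j)) 0) (B (suc (toℕ i)) 0)) (cong bit (∧-comm (B (suc (toℕ j)) 0) (B (suc (toℕ i)) 0))))))))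
  (subst (λ b → det (suc N) (λ i j → bit (schur B (toℕ i) (toℕ j))) ~ not b) (schur-defect adm B₀₀ N)
    (det-defect N (λ n → B (suc n) 0) (schur-admissible adm B₀₀) λ k k<N →
      trans (schur-defect adm B₀₀ k) (small (suc k) (s<s k<N))))
  where
  open Admissible adm
  B₀₀ : B 0 0 ≡ true
  B₀₀ = not≡false⇒true (small 0 z<s)
  M : Fin (suc (suc N)) → Fin (suc (suc N)) → ℤ
  M i j = bit (B (toℕ i) (toℕ j))

-- Sign sequences and their Hankel determinants

sgn : Bool → ℤ
sgn false = + 1
sgn true  = - + 1

sgn-* : ∀ a b → sgn a * sgn b ≡ sgn (a xor b)
sgn-* false false = refl
sgn-* false true  = refl
sgn-* true  false = refl
sgn-* true  true  = refl

sgn-neg : ∀ b → - sgn b ≡ sgn (not b)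
sgn-neg false = refl
sgn-neg true  = refl

sgn-injective : ∀ {a b} → sgn a ≡ sgn b → a ≡ b
sgn-injective {false} {false} _ = refl
sgn-injective {true}  {true}  _ = refl

sgn≡1-2bit : ∀ b → sgn b ≡ + 1 - + 2 * bit b
sgn≡1-2bit false = refl
sgn≡1-2bit true  = refl

sgn-diff : ∀ a b → sgn a - sgn b ≡ + 2 * (bit b - bit a)
sgn-diff a b = trans (cong₂ _-_ (sgn≡1-2bit a) (sgn≡1-2bit b)) (lemma (bit a) (bit b))
  where
  lemma : ∀ a b → (+ 1 - + 2 * a) - (+ 1 - + 2 * b) ≡ + 2 * (b - a)
  lemma = solve-∀

-- The quantity t_n. It is applied both to the exponents of the fixed point and to those of the
-- periodically extended word, where it expresses the congruence of the odd case.
turn : (ℕ → Bool) → ℕ → Bool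
turn e n = (e n xor e (suc n)) xor (e (suc (2 ℕ.* n)) xor e (suc (suc (2 ℕ.* n))))

2^n≢0 : ∀ n → ℤ.NonZero ((+ 2) ^ n)
2^n≢0 zero    = _
2^n≢0 (suc n) = ℤ.i*j≢0 (+ 2) ((+ 2) ^ n) {{_}} {{2^n≢0 n}}

module Criterion (d : ℕ → ℤ) (e : ℕ → Bool) (d≡sgn : ∀ n → d n ≡ sgn (e n)) (e₀ : e 0 ≡ false) where

  B : ℕ → ℕ → Bool
  B i j = e (suc (suc (i ℕ.+ j))) xor (e (suc i) xor e (suc j))

  B-admissible : Admissible (λ _ → true) B
  B-admissible .Admissible.symmetric i j =
    cong₂ _xor_ (cong (λ m → e (suc (suc m))) (ℕ.+-comm i j)) (xor-comm (e (suc i)) (e (suc j)))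
  B-admissible .Admissible.shift i j
    rewrite ℕ.+-suc i j | ℕ.+-identityʳ i | ℕ.+-identityʳ j
    = solve 6 (λ x a b a′ b′ c →
        x :+ (a :+ b′) := (x :+ (a′ :+ b)) :+ ((b′ :+ (b :+ c)) :+ ((a′ :+ (a :+ c)) :* con true))) refl
        (e (suc (suc (suc (i ℕ.+ j))))) (e (suc i)) (e (suc j)) (e (suc (suc i))) (e (suc (suc j))) (e 1)

  -- As `φ` is constantly true, so is the disjunction. On the diagonal of `B` the two equal terms
  -- cancel, leaving a single letter of even index. The first case uses `e 0 ≡ false`.
  defect≡not-turn : ∀ n → defect (λ _ → true) B n ≡ not (turn e n)
  defect≡not-turn zero rewrite e₀ = solve 2 (λ a b →
    con true :+ (b :+ (a :+ a)) := con true :+ (a :+ (a :+ b))) refl (e 1) (e 2)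
  defect≡not-turn (suc n) rewrite ℕ.+-identityʳ n = solve 4 (λ x y a b →
    ((x :+ (b :+ b)) :+ (y :+ (a :+ b))) :+ con true := con true :+ ((a :+ b) :+ (y :+ x))) refl
    (e (suc (suc (suc (n ℕ.+ suc n))))) (e (suc (suc (n ℕ.+ suc n)))) (e (suc n)) (e (suc (suc n)))

  -- The exact integer halves of the Schur complement entries, hence a difference of bits; only its
  -- parity agrees with `B`.
  C : ∀ n → Fin n → Fin n → ℤ
  C n i j = bit (e (suc (toℕ j)) xor e (suc (toℕ i))) - bit (e (suc (toℕ i) ℕ.+ suc (toℕ j)))

  hankel : ∀ n → H (suc n) d ≡ (+ 2) ^ n * det n (C n)
  hankel n = begin
    H (suc n) d
      ≡⟨ det-schur n (λ i j → d (toℕ i ℕ.+ toℕ j)) (trans (d≡sgn 0) (cong sgn e₀)) ⟩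
    det n (λ i j → d (suc (toℕ i) ℕ.+ suc (toℕ j)) - d (suc (toℕ j)) * d (suc (toℕ i) ℕ.+ 0))
      ≡⟨ det-cong n (λ i j → entry (suc (toℕ i)) (suc (toℕ j))) ⟩
    det n (λ i j → + 2 * C n i j)
      ≡⟨ det-scale n (+ 2) (C n) ⟩
    (+ 2) ^ n * det n (C n) ∎
    where
    entry : ∀ i j → d (i ℕ.+ j) - d j * d (i ℕ.+ 0) ≡ + 2 * (bit (e j xor e i) - bit (e (i ℕ.+ j)))
    entry i j = begin
      d (i ℕ.+ j) - d j * d (i ℕ.+ 0)
        ≡⟨ cong₂ _-_ (d≡sgn (i ℕ.+ j)) (cong₂ _*_ (d≡sgn j) (trans (cong d (ℕ.+-identityʳ i)) (d≡sgn i))) ⟩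
      sgn (e (i ℕ.+ j)) - sgn (e j) * sgn (e i)
        ≡⟨ cong (_-_ (sgn (e (i ℕ.+ j)))) (sgn-* (e j) (e i)) ⟩
      sgn (e (i ℕ.+ j)) - sgn (e j xor e i)
        ≡⟨ sgn-diff (e (i ℕ.+ j)) (e j xor e i) ⟩
      + 2 * (bit (e j xor e i) - bit (e (i ℕ.+ j))) ∎

  det-C : ∀ n → (∀ k → k < n → turn e k ≡ true) → det (suc n) (C (suc n)) ~ turn e n
  det-C n small = ≈₂-trans (det-cong₂ (suc n) entry)
    (subst (det (suc n) (λ i j → bit (B (toℕ i) (toℕ j))) ~_) (trans (cong not (defect≡not-turn n)) (not-involutive _))
      (det-defect n _ B-admissible λ k k<n → trans (defect≡not-turn k) (cong not (small k k<n))))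
    where
    entry : ∀ (i j : Fin (suc n)) → C (suc n) i j ≈₂ bit (B (toℕ i) (toℕ j))
    entry i j = subst (C (suc n) i j ~_) eq
      (minus-~ (e (suc (toℕ j)) xor e (suc (toℕ i))) _ (bit-~ _) (bit-~ (e (suc (toℕ i) ℕ.+ suc (toℕ j)))))
      where
      eq : (e (suc (toℕ j)) xor e (suc (toℕ i))) xor e (suc (toℕ i) ℕ.+ suc (toℕ j)) ≡ B (toℕ i) (toℕ j)
      eq rewrite ℕ.+-suc (toℕ i) (toℕ j) = trans (xor-comm (e (suc (toℕ j)) xor e (suc (toℕ i))) _)
        (cong (e (suc (suc (toℕ i ℕ.+ toℕ j))) xor_) (xor-comm (e (suc (toℕ j))) (e (suc (toℕ i)))))

  apwenian⇔ : Apwenian d ⇔ (∀ n → turn e n ≡ true)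
  apwenian⇔ = mk⇔ to from
    where
    quotient : ∀ n → (∀ k → k < n → turn e k ≡ true) →
      QuotOdd ((+ 2) ^ suc n) (H (suc (suc n)) d) ⇔ turn e n ≡ true
    quotient n small = quotOdd-⇔ {(+ 2) ^ suc n} {{2^n≢0 (suc n)}} (hankel (suc n)) (det-C n small)
    to : Apwenian d → ∀ n → turn e n ≡ true
    -- Strong induction is forced: the determinant of order n+2 reveals `turn e n` only once all
    -- earlier turns are known.
    to apw = <-rec _ λ n small → Equivalence.to (quotient n λ k k<n → small k<n) (apw (suc n))
    from : (∀ n → turn e n ≡ true) → Apwenian d
    -- The order-1 determinant is d_0 = 1, with quotient 1; from here on the indices are offset by
    -- one.
    from all zero    = + 1 , hankel 0 , + 0 , refl
    from all (suc n) = Equivalence.from (quotient n λ k _ → all k) (all n)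

-- Fixed points of substitutions

2*suc : ∀ n → 2 ℕ.* suc n ≡ suc (suc (2 ℕ.* n))
2*suc = ℕ-Solver.solve-∀

odd∣2*m⇒∣m : ∀ {p m} → p % 2 ≡ 1 → p ∣ 2 ℕ.* m → p ∣ m
odd∣2*m⇒∣m {p} {m} odd (divides q eq) with euclidsLemma q p prime[2] (divides m (trans (sym eq) (ℕ.*-comm 2 m)))
... | inj₁ (divides c q≡c*2) = divides c (ℕ.*-cancelˡ-≡ m (c ℕ.* p) 2 (begin
  2 ℕ.* m         ≡⟨ eq ⟩
  q ℕ.* p         ≡⟨ cong (ℕ._* p) q≡c*2 ⟩
  c ℕ.* 2 ℕ.* p   ≡⟨ lemma c p ⟩
  2 ℕ.* (c ℕ.* p) ∎))
  where
  lemma : ∀ c p → c ℕ.* 2 ℕ.* p ≡ 2 ℕ.* (c ℕ.* p)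
  lemma = ℕ-Solver.solve-∀
... | inj₂ 2∣p = contradiction (trans (sym odd) (n∣m⇒m%n≡0 p 2 2∣p)) λ ()

xor-cancelˡ : ∀ a {b c} → a xor b ≡ a xor c → b ≡ c
xor-cancelˡ false b≡c = b≡c
xor-cancelˡ true {b} {c} eq = trans (sym (not-involutive b)) (trans (cong not eq) (not-involutive c))

IsThueMorse : (ℕ → Bool) → Set
IsThueMorse e = (∀ n → e (2 ℕ.* n) ≡ e n) × (∀ n → e (suc (2 ℕ.* n)) ≡ not (e n))

thueMorse⇒turn : ∀ {e} → IsThueMorse e → ∀ n → turn e n ≡ true
thueMorse⇒turn {e} (even , odd) n = begin
  (e n xor e (suc n)) xor (e (suc (2 ℕ.* n)) xor e (suc (suc (2 ℕ.* n))))
    ≡⟨ cong₂ (λ a b → (e n xor e (suc n)) xor (a xor b)) (odd n)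
         (trans (cong e (sym (2*suc n))) (even (suc n))) ⟩
  (e n xor e (suc n)) xor (not (e n) xor e (suc n))
    ≡⟨ solve 2 (λ a b → (a :+ b) :+ ((con true :+ a) :+ b) := con true) refl (e n) (e (suc n)) ⟩
  true ∎

module FixedPoint (p : ℕ) .{{_ : NonZero p}} (2≤p : 2 ≤ p) (e w : ℕ → Bool)
  (fixed : ∀ m → e m ≡ e (m / p) xor w m) (periodic : ∀ m k → w (m ℕ.+ k ℕ.* p) ≡ w m)
  (e₀ : e 0 ≡ false) (w₀ : w 0 ≡ false) where

  block : ∀ {j} q → j < p → e (j ℕ.+ q ℕ.* p) ≡ e q xor w j
  block {j} q j<p = trans (fixed (j ℕ.+ q ℕ.* p)) (cong₂ (λ a b → e a xor b) quotient (periodic j q))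
    where
    quotient : (j ℕ.+ q ℕ.* p) / p ≡ q
    quotient = begin
      (j ℕ.+ q ℕ.* p) / p     ≡⟨ +-distrib-/-∣ʳ j (n∣m*n q) ⟩
      j / p ℕ.+ q ℕ.* p / p   ≡⟨ cong₂ ℕ._+_ (m<n⇒m/n≡0 j<p) (m*n/n≡m q p) ⟩
      q                       ∎

  block₀ : ∀ q → e (q ℕ.* p) ≡ e q
  block₀ q = begin
    e (q ℕ.* p)   ≡⟨ block q (ℕ.≤-trans z<s 2≤p) ⟩
    e q xor w 0   ≡⟨ cong (e q xor_) w₀ ⟩
    e q xor false ≡⟨ xor-identityʳ (e q) ⟩
    e q           ∎

  suc-mod< : ∀ n → ¬ p ∣ suc n → suc (n % p) < p
  suc-mod< n p∤ = ℕ.≤∧≢⇒< (m%n<n n p) λ eq →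
    p∤ (divides (suc (n / p)) (trans (cong suc (m≡m%n+[m/n]*n n p)) (cong (ℕ._+ n / p ℕ.* p) eq)))

  interior : ∀ m → ¬ p ∣ suc m → e m xor e (suc m) ≡ w m xor w (suc m)
  interior m p∤ = begin
    e m xor e (suc m)
      ≡⟨ cong (λ n → e n xor e (suc n)) m≡ ⟩
    e (j ℕ.+ q ℕ.* p) xor e (suc j ℕ.+ q ℕ.* p)
      ≡⟨ cong₂ _xor_ (block q (m%n<n m p)) (block q (suc-mod< m p∤)) ⟩
    (e q xor w j) xor (e q xor w (suc j))
      ≡⟨ solve 3 (λ a b c → (a :+ b) :+ (a :+ c) := b :+ c) refl (e q) (w j) (w (suc j)) ⟩
    w j xor w (suc j)
      ≡⟨ sym (cong₂ _xor_ (periodic j q) (periodic (suc j) q)) ⟩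
    w (j ℕ.+ q ℕ.* p) xor w (suc j ℕ.+ q ℕ.* p)
      ≡⟨ cong (λ n → w n xor w (suc n)) (sym m≡) ⟩
    w m xor w (suc m) ∎
    where
    j q : ℕ
    j = m % p
    q = m / p
    m≡ : m ≡ j ℕ.+ q ℕ.* p
    m≡ = m≡m%n+[m/n]*n m p

  -- Position m carries the last letter of block q and m+1 the first letter of block q+1, which is
  -- unchanged because `w 0` is false.
  boundary : ∀ m q → suc m ≡ suc q ℕ.* p → e m xor e (suc m) ≡ (e q xor e (suc q)) xor w (pred p)
  boundary m q eq = begin
    e m xor e (suc m)
      ≡⟨ cong₂ (λ a b → e a xor e b) m≡ eq ⟩
    e (pred p ℕ.+ q ℕ.* p) xor e (suc q ℕ.* p)
      ≡⟨ cong₂ _xor_ (block q pred<) (block₀ (suc q)) ⟩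
    (e q xor w (pred p)) xor e (suc q)
      ≡⟨ solve 3 (λ a b c → (a :+ b) :+ c := (a :+ c) :+ b) refl (e q) (w (pred p)) (e (suc q)) ⟩
    (e q xor e (suc q)) xor w (pred p) ∎
    where
    pred< : pred p < p
    pred< = ℕ.≤-reflexive (ℕ.suc-pred p)
    m≡ : m ≡ pred p ℕ.+ q ℕ.* p
    m≡ = ℕ.suc-injective (trans eq (cong (ℕ._+ q ℕ.* p) (sym (ℕ.suc-pred p))))

  turn-periodic : ∀ j k → turn w (j ℕ.+ k ℕ.* p) ≡ turn w j
  turn-periodic j k = cong₂ _xor_
    (cong₂ _xor_ (periodic j k) (periodic (suc j) k))
    (cong₂ _xor_ (double 1) (double 2))
    where
    double : ∀ c → w (c ℕ.+ 2 ℕ.* (j ℕ.+ k ℕ.* p)) ≡ w (c ℕ.+ 2 ℕ.* j)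
    double c = trans (cong w (lemma c j k p)) (periodic (c ℕ.+ 2 ℕ.* j) (2 ℕ.* k))
      where
      lemma : ∀ c j k p → c ℕ.+ 2 ℕ.* (j ℕ.+ k ℕ.* p) ≡ (c ℕ.+ 2 ℕ.* j) ℕ.+ (2 ℕ.* k) ℕ.* p
      lemma = ℕ-Solver.solve-∀

  -- Doubling gives 2n+2 = (2q+2)p, so both pairs of letters straddle block boundaries and the two
  -- copies of `w (pred p)` cancel.
  turn-boundary : ∀ n q → suc n ≡ suc q ℕ.* p → turn e n ≡ turn e q
  turn-boundary n q eq = begin
    turn e n
      ≡⟨ cong₂ _xor_ (boundary n q eq) (boundary (suc (2 ℕ.* n)) (suc (2 ℕ.* q)) eq₂) ⟩
    ((e q xor e (suc q)) xor w (pred p)) xor ((e (suc (2 ℕ.* q)) xor e (suc (suc (2 ℕ.* q)))) xor w (pred p))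
      ≡⟨ solve 3 (λ a b c → (a :+ c) :+ (b :+ c) := a :+ b) refl
           (e q xor e (suc q)) (e (suc (2 ℕ.* q)) xor e (suc (suc (2 ℕ.* q)))) (w (pred p)) ⟩
    turn e q ∎
    where
    eq₂ : suc (suc (2 ℕ.* n)) ≡ suc (suc (2 ℕ.* q)) ℕ.* p
    eq₂ = begin
      suc (suc (2 ℕ.* n))         ≡⟨ sym (2*suc n) ⟩
      2 ℕ.* suc n                 ≡⟨ cong (2 ℕ.*_) eq ⟩
      2 ℕ.* (suc q ℕ.* p)         ≡⟨ sym (ℕ.*-assoc 2 (suc q) p) ⟩
      2 ℕ.* suc q ℕ.* p           ≡⟨ cong (ℕ._* p) (2*suc q) ⟩
      suc (suc (2 ℕ.* q)) ℕ.* p   ∎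

  -- For odd p, if p does not divide n+1 then it does not divide 2n+2 either, so each of the two
  -- pairs lies inside one block and its block sign cancels.
  turn-interior : p % 2 ≡ 1 → ∀ n → ¬ p ∣ suc n → turn e n ≡ turn w n
  turn-interior odd n p∤ = cong₂ _xor_ (interior n p∤) (interior (suc (2 ℕ.* n)) λ p∣ →
    p∤ (odd∣2*m⇒∣m odd (subst (p ∣_) (sym (2*suc n)) p∣)))

  odd-criterion : p % 2 ≡ 1 → (∀ n → turn e n ≡ true) ⇔ (∀ j → suc j < p → turn w j ≡ true)
  odd-criterion odd = mk⇔
    (λ all j j<p → trans (sym (turn-interior odd j (>⇒∤ j<p))) (all j))
    (λ word → <-rec _ (step word))
    where
    step : (∀ j → suc j < p → turn w j ≡ true) → ∀ n → (∀ {m} → m < n → turn e m ≡ true) → turn e n ≡ true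
    step word n rec with p ∣? suc n
    -- The descent is strict: q+1 < (q+1)p = n+1 because p is at least 2.
    ... | yes (divides (suc q) eq) = trans (turn-boundary n q eq)
      (rec (ℕ.s<s⁻¹ (subst (suc q <_) (sym eq) (ℕ.m<m*n (suc q) p 2≤p))))
    ... | no p∤ = begin
      turn e n                            ≡⟨ turn-interior odd n p∤ ⟩
      turn w n                            ≡⟨ cong (turn w) (m≡m%n+[m/n]*n n p) ⟩
      turn w (n % p ℕ.+ (n / p) ℕ.* p)    ≡⟨ turn-periodic (n % p) (n / p) ⟩
      turn w (n % p)                      ≡⟨ word (n % p) (suc-mod< n p∤) ⟩
      true                                ∎

  -- Substitutions of even length

  module Even (k : ℕ) (p≡ : p ≡ suc k ℕ.* 2) (all : ∀ n → turn e n ≡ true) where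

    -- As p = 2(k+1), for n = k + qp the letters 2n+1 and 2n+2 straddle the boundary between blocks 2q and 2q+1.
    pair : ∀ q → e (2 ℕ.* q) xor e (suc (2 ℕ.* q)) ≡ e 1
    -- The constant `c` is the same for every q, so comparing with q = 0, where the pair is
    -- `e 0 xor e 1`, removes it without evaluating it.
    pair q = trans (xor-cancelˡ c (trans (sym (straddle q)) (trans (trans (all _) (sym (all _))) (straddle 0))))
      (cong (_xor e 1) e₀)
      where
      c : Bool
      c = (w k xor w (suc k)) xor w (pred p)
      k<p : suc k < p
      k<p = subst (suc k <_) (sym p≡) (ℕ.m<m*n (suc k) 2 (ℕ.≤-refl))
      straddle : ∀ q → turn e (k ℕ.+ q ℕ.* p) ≡ c xor (e (2 ℕ.* q) xor e (suc (2 ℕ.* q)))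
      straddle q = begin
        turn e n
          ≡⟨ cong₂ _xor_
               (trans (interior n (λ p∣ → >⇒∤ k<p (∣m+n∣m⇒∣n (subst (p ∣_) (ℕ.+-comm (suc k) (q ℕ.* p)) p∣) (n∣m*n q))))
                 (cong₂ _xor_ (periodic k q) (periodic (suc k) q)))
               (boundary (suc (2 ℕ.* n)) (2 ℕ.* q) eq) ⟩
        (w k xor w (suc k)) xor ((e (2 ℕ.* q) xor e (suc (2 ℕ.* q))) xor w (pred p))
          ≡⟨ solve 3 (λ a b c → a :+ (b :+ c) := (a :+ c) :+ b) refl
               (w k xor w (suc k)) (e (2 ℕ.* q) xor e (suc (2 ℕ.* q))) (w (pred p)) ⟩
        c xor (e (2 ℕ.* q) xor e (suc (2 ℕ.* q))) ∎
        where
        n : ℕ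
        n = k ℕ.+ q ℕ.* p
        lemma : ∀ k x → suc (suc (2 ℕ.* (k ℕ.+ x))) ≡ suc k ℕ.* 2 ℕ.+ 2 ℕ.* x
        lemma = ℕ-Solver.solve-∀
        eq : suc (suc (2 ℕ.* n)) ≡ suc (2 ℕ.* q) ℕ.* p
        eq = begin
          suc (suc (2 ℕ.* n))                    ≡⟨ lemma k (q ℕ.* p) ⟩
          suc k ℕ.* 2 ℕ.+ 2 ℕ.* (q ℕ.* p)        ≡⟨ cong₂ ℕ._+_ (sym p≡) (sym (ℕ.*-assoc 2 q p)) ⟩
          suc (2 ℕ.* q) ℕ.* p                    ∎

    odd-letter : ∀ n → e (suc (2 ℕ.* n)) ≡ e (2 ℕ.* n) xor e 1
    odd-letter n = xor-cancelˡ (e (2 ℕ.* n)) (trans (pair n)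
      (solve 2 (λ a b → b := a :+ (a :+ b)) refl (e (2 ℕ.* n)) (e 1)))

    g : ℕ → Bool
    g n = e n xor e (2 ℕ.* n)

    -- Adding `turn e n`, which is 1, trades the letters at n+1 and 2n+2 for those at n and 2n+1;
    -- `odd-letter` then returns from 2n+1 to 2n.
    g-suc : ∀ n → g (suc n) ≡ g n xor not (e 1)
    g-suc n = begin
      e (suc n) xor e (2 ℕ.* suc n)
        ≡⟨ cong (λ m → e (suc n) xor e m) (2*suc n) ⟩
      e (suc n) xor e (suc (suc (2 ℕ.* n)))
        ≡⟨ solve 4 (λ a b c d → b :+ d := ((a :+ b) :+ (c :+ d)) :+ (a :+ c)) refl
             (e n) (e (suc n)) (e (suc (2 ℕ.* n))) (e (suc (suc (2 ℕ.* n)))) ⟩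
      turn e n xor (e n xor e (suc (2 ℕ.* n)))
        ≡⟨ cong₂ (λ a b → a xor (e n xor b)) (all n) (odd-letter n) ⟩
      true xor (e n xor (e (2 ℕ.* n) xor e 1))
        ≡⟨ solve 3 (λ a b c → con true :+ (a :+ (b :+ c)) := (a :+ b) :+ (con true :+ c)) refl
             (e n) (e (2 ℕ.* n)) (e 1) ⟩
      g n xor not (e 1) ∎

    g-zero : g 0 ≡ false
    g-zero = xor-same (e 0)

    -- Two successive increments cancel whatever the value of `e 1`, so this is available before
    -- that value is known.
    g-even : ∀ n → g (n ℕ.* 2) ≡ false
    g-even zero    = g-zero
    g-even (suc n) = begin
      g (suc (suc (n ℕ.* 2)))                         ≡⟨ trans (g-suc _) (cong (_xor not (e 1)) (g-suc _)) ⟩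
      (g (n ℕ.* 2) xor not (e 1)) xor not (e 1)       ≡⟨ solve 2 (λ a b → (a :+ b) :+ b := a) refl (g (n ℕ.* 2)) (not (e 1)) ⟩
      g (n ℕ.* 2)                                     ≡⟨ g-even n ⟩
      false                                           ∎

    e₁ : e 1 ≡ true
    e₁ = not≡false⇒true (begin
      not (e 1)       ≡⟨ sym (trans (g-suc 0) (cong (_xor not (e 1)) g-zero)) ⟩
      -- Positions p and 2p start blocks 1 and 2, so `g p` is also `e 1 xor e 2`.
      e 1 xor e 2     ≡⟨ sym (cong₂ _xor_ (trans (cong e (sym (ℕ.*-identityˡ p))) (block₀ 1)) (block₀ 2)) ⟩
      g p             ≡⟨ cong g p≡ ⟩
      g (suc k ℕ.* 2) ≡⟨ g-even (suc k) ⟩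
      false           ∎)

    g≡false : ∀ n → g n ≡ false
    g≡false zero    = g-zero
    g≡false (suc n) = trans (g-suc n) (cong₂ (λ a b → a xor not b) (g≡false n) e₁)

    thueMorse : IsThueMorse e
    thueMorse = even , λ n → begin
      e (suc (2 ℕ.* n))   ≡⟨ odd-letter n ⟩
      e (2 ℕ.* n) xor e 1 ≡⟨ cong₂ _xor_ (even n) e₁ ⟩
      e n xor true        ≡⟨ xor-comm (e n) true ⟩
      not (e n)           ∎
      where
      even : ∀ n → e (2 ℕ.* n) ≡ e n
      even n = xor-cancelˡ (e n) (trans (g≡false n) (sym (xor-same (e n))))

  even-criterion : p % 2 ≡ 0 → (∀ n → turn e n ≡ true) ⇔ IsThueMorse e
  even-criterion p%2≡0 with m%n≡0⇒n∣m p 2 p%2≡0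
  ... | divides zero    p≡ = contradiction (subst (2 ≤_) p≡ 2≤p) λ ()
  ... | divides (suc k) p≡ = mk⇔ (Even.thueMorse k p≡) thueMorse⇒turn

-- Translation between signs and exponents

signBit : ∀ {x} → IsSign x → Bool
signBit (inj₁ _) = false
signBit (inj₂ _) = true

sgn-signBit : ∀ {x} (s : IsSign x) → x ≡ sgn (signBit s)
sgn-signBit (inj₁ x≡1)  = x≡1
sgn-signBit (inj₂ x≡-1) = x≡-1

-- Regrouping as (x - z) - (u - y) makes each bracket twice a difference of bits, which exhibits the
-- quotient `q` and its parity.
four-signs : ∀ {x y z u} a b c d → x ≡ sgn a → y ≡ sgn b → z ≡ sgn c → u ≡ sgn d →
  QuotOdd (+ 2) ((x + y) - (z + u)) ⇔ (a xor b) xor (c xor d) ≡ true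
four-signs a b c d refl refl refl refl = quotOdd-⇔ {+ 2} eq parity
  where
  q : ℤ
  q = (bit c - bit a) - (bit b - bit d)
  eq : (sgn a + sgn b) - (sgn c + sgn d) ≡ + 2 * q
  eq = trans (split (sgn a) (sgn b) (sgn c) (sgn d)) 
    (trans (cong₂ _-_ (sgn-diff a c) (sgn-diff d b)) (factor (bit c - bit a) (bit b - bit d)))
    where
    split : ∀ a b c d → (a + b) - (c + d) ≡ (a - c) - (d - b)
    split = solve-∀
    factor : ∀ x y → + 2 * x - + 2 * y ≡ + 2 * (x - y)
    factor = solve-∀
  parity : q ~ (a xor b) xor (c xor d)
  parity = subst (q ~_)
    (solve 4 (λ a b c d → (c :+ a) :+ (b :+ d) := (a :+ b) :+ (c :+ d)) refl a b c d)
    (minus-~ (c xor a) (b xor d) (minus-~ c a (bit-~ c) (bit-~ a)) (minus-~ b d (bit-~ b) (bit-~ d)))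

theorem5p2 : (p : ℕ) .{{_ : NonZero p}} → 2 ≤ p →
    (v : Fin p → ℤ) → ((i : Fin p) → IsSign (v i)) → vext p v 0 ≡ + 1 →
    (d : ℕ → ℤ) → IsFixedPointFrom1 p v d →
    ((p % 2 ≡ 1) →
    (Apwenian d ⇔ ((j : ℕ) → suc j < p →
    QuotOdd (+ 2) ((vext p v j + vext p v (suc j)) - (vext p v (suc (2 ℕ.* j)) + vext p v (suc (suc (2 ℕ.* j)))))))) ×
    ((p % 2 ≡ 0) → (Apwenian d ⇔ ThueMorse d))
theorem5p2 p 2≤p v v-sign v₀ d (d-sign , d₀ , d-fixed) =
    (λ odd → word⇔ ⇔-∘ (odd-criterion odd ⇔-∘ apwenian⇔))
  , (λ even → thueMorse⇔ ⇔-∘ (even-criterion even ⇔-∘ apwenian⇔))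
  where
  e w : ℕ → Bool
  e m = signBit (d-sign m)
  w m = signBit (v-sign (fromℕ< (m%n<n m p)))

  d≡sgn : ∀ m → d m ≡ sgn (e m)
  d≡sgn m = sgn-signBit (d-sign m)

  v≡sgn : ∀ m → vext p v m ≡ sgn (w m)
  v≡sgn m = sgn-signBit (v-sign (fromℕ< (m%n<n m p)))

  e₀ : e 0 ≡ false
  e₀ = sgn-injective (trans (sym (d≡sgn 0)) d₀)

  w₀ : w 0 ≡ false
  w₀ = sgn-injective (trans (sym (v≡sgn 0)) v₀)

  fixed : ∀ m → e m ≡ e (m / p) xor w m
  fixed m = sgn-injective (begin
    sgn (e m)                   ≡⟨ sym (d≡sgn m) ⟩
    d m                         ≡⟨ sym (d-fixed m) ⟩
    d (m / p) * vext p v m      ≡⟨ cong₂ _*_ (d≡sgn (m / p)) (v≡sgn m) ⟩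
    sgn (e (m / p)) * sgn (w m) ≡⟨ sgn-* (e (m / p)) (w m) ⟩
    sgn (e (m / p) xor w m)     ∎)

  periodic : ∀ m k → w (m ℕ.+ k ℕ.* p) ≡ w m
  -- The bit is read from a sign proof attached to an element of `Fin p`, so it suffices that the
  -- two reduced indices are equal as elements of `Fin p`.
  periodic m k = cong (signBit ∘ v-sign) (fromℕ<-cong _ _ ([m+kn]%n≡m%n m k p) _ _)

  open Criterion d e d≡sgn e₀ using (apwenian⇔)
  open FixedPoint p 2≤p e w fixed periodic e₀ w₀ using (odd-criterion; even-criterion)

  condition⇔ : ∀ j →
    QuotOdd (+ 2) ((vext p v j + vext p v (suc j)) - (vext p v (suc (2 ℕ.* j)) + vext p v (suc (suc (2 ℕ.* j)))))
    ⇔ turn w j ≡ true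
  condition⇔ j =
    four-signs (w j) (w (suc j)) (w (suc (2 ℕ.* j))) (w (suc (suc (2 ℕ.* j))))
      (v≡sgn j) (v≡sgn (suc j)) (v≡sgn (suc (2 ℕ.* j))) (v≡sgn (suc (suc (2 ℕ.* j))))

  word⇔ : (∀ j → suc j < p → turn w j ≡ true) ⇔ ((j : ℕ) → suc j < p →
    QuotOdd (+ 2) ((vext p v j + vext p v (suc j)) - (vext p v (suc (2 ℕ.* j)) + vext p v (suc (suc (2 ℕ.* j))))))
  word⇔ = mk⇔ (λ word j j<p → Equivalence.from (condition⇔ j) (word j j<p))
              (λ word j j<p → Equivalence.to (condition⇔ j) (word j j<p))

  thueMorse⇔ : IsThueMorse e ⇔ ThueMorse d
  thueMorse⇔ = mk⇔
    (λ (even , odd) → d₀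
      , (λ n → trans (d≡sgn _) (trans (cong sgn (even n)) (sym (d≡sgn n))))
      , (λ n → trans (d≡sgn _) (trans (cong sgn (odd n)) (trans (sym (sgn-neg (e n))) (cong -_ (sym (d≡sgn n)))))))
    (λ (_ , even , odd) →
        (λ n → sgn-injective (trans (sym (d≡sgn _)) (trans (even n) (d≡sgn n))))
      , (λ n → sgn-injective (trans (sym (d≡sgn _)) (trans (odd n) (trans (cong -_ (d≡sgn n)) (sgn-neg (e n)))))))
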